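{- Let $G$ be an edge-colored graph on $n$ vertices. If $e(G)+c(G)\geq n(n+1)/2$, then $G$ contains a rainbow triangle.
   Context: All graphs are simple and finite, with at least one vertex. An edge-colored graph is a graph $G=(V,E)$ together with an arbitrary mapping $C:E\to\mathbb{N}$ (not required to be a proper edge-coloring). $e(G)$ denotes the number of edges of $G$, and $c(G)$ (the color number) denotes the number of distinct colors appearing on the edges of $G$. A rainbow triangle is a triangle of $G$ whose three edges have pairwise distinct colors. -}

module Defs where

open import Data.Fin.Base using (Fin; _<_)
open import Data.Fin.Properties using (_<?_)
open import Data.List.Base
  using (List; length; map; mapMaybe; deduplicate; allFin; cartesianProduct)
open import Data.Maybe.Base using (Maybe; just; nothing)
open import Data.Nat.Base using (ℕ)
open import Data.Nat.Properties using (_≟_)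
open import Data.Product.Base using (_×_; _,_)
open import Level using (0ℓ)
open import Relation.Binary.Core using (Rel)
open import Relation.Binary.Definitions using (Decidable; Irreflexive; Symmetric)
open import Relation.Binary.PropositionalEquality.Core using (_≡_; _≢_)
open import Relation.Nullary.Decidable.Core using (yes; no)

record SimpleGraph (n : ℕ) : Set₁ where
  field
    Adj    : Rel (Fin n) 0ℓ
    adj?   : Decidable Adj
    symm   : Symmetric Adj
    irrefl : Irreflexive _≡_ Adj

-- The adjacency proof is irrelevant, so a colour depends only on the pair of
-- endpoints; with colour-sym it depends only on the unordered pair.
record EdgeColouredGraph (n : ℕ) : Set₁ where
  field
    graph : SimpleGraph n

  open SimpleGraph graph public

  field
    colour     : ∀ u v → .(Adj u v) → ℕ
    colour-sym : ∀ {u v} (uv : Adj u v) → colour u v uv ≡ colour v u (symm uv)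

module _ {n : ℕ} (G : EdgeColouredGraph n) where
  open EdgeColouredGraph G

  -- Each unordered edge is represented once, by its increasing orientation.
  record Edge : Set where
    constructor mkEdge
    field
      src tgt  : Fin n
      .src<tgt : src < tgt
      .adj     : Adj src tgt

  edge? : Fin n × Fin n → Maybe Edge
  edge? (u , v) with u <? v | adj? u v
  ... | yes u<v | yes uv = just (mkEdge u v u<v uv)
  ... | yes _   | no _   = nothing
  ... | no _    | _      = nothing

  edges : List Edge
  edges = mapMaybe edge? (cartesianProduct (allFin n) (allFin n))

  edgeColour : Edge → ℕ
  edgeColour (mkEdge u v _ uv) = colour u v uv

  edgeCount : ℕ
  edgeCount = length edges

  colourCount : ℕ
  colourCount = length (deduplicate _≟_ (map edgeColour edges))

  -- The three vertices are distinct because adjacency is irreflexive.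
  record RainbowTriangle : Set where
    field
      u v w : Fin n
      uv    : Adj u v
      vw    : Adj v w
      uw    : Adj u w
      uv≢vw : colour u v uv ≢ colour v w vw
      uv≢uw : colour u v uv ≢ colour u w uw
      vw≢uw : colour v w vw ≢ colour u w uw

{-# OPTIONS --safe #-}

-- In a graph without rainbow triangles let v have minimum degree, and pick one
-- neighbour of v for each colour that occurs only at v.  Two picked neighbours
-- x, y cannot be adjacent: the colours of vx and vy differ and neither occurs
-- on xy.  So a picked x is adjacent to no picked vertex, whence
-- deg v ≤ deg x ≤ n − #picked, and removing v lowers e + c by at most n.
-- By induction e + c < n (n + 1) / 2.
module Submission where

open import Defs
open import Data.Fin.Base using (Fin; _<_)
open import Data.Fin.Properties using (_<?_; <-asym; any?)
open import Data.List.Base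
  using (List; []; _∷_; _++_; [_]; length; map; mapMaybe; filter; deduplicate;
         allFin; cartesianProduct)
open import Data.List.Extrema.Nat using (argmin; argmin-sel; f[argmin]≤f[⊤]; f[argmin]≤f[xs])
open import Data.List.Membership.Propositional using (_∈_)
open import Data.List.Membership.Propositional.Properties
open import Data.List.Properties using (length-++; length-map; length-tabulate)
open import Data.List.Relation.Binary.Permutation.Propositional
  using (_↭_; ↭⇒↭ₛ; ↭-reflexive; ↭-trans)
open import Data.List.Relation.Binary.Permutation.Propositional.Properties
  using (∈-resp-↭; ↭-length; shift)
open import Data.List.Relation.Binary.Permutation.Setoid.Properties using (Unique-resp-↭)
open import Data.List.Relation.Binary.Disjoint.Propositional using (Disjoint)
open import Data.List.Relation.Binary.Subset.Propositional using (_⊆_)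
open import Data.List.Relation.Unary.All as All using ([]; _∷_)
open import Data.List.Relation.Unary.AllPairs as AllPairs using (AllPairs; []; _∷_)
open import Data.List.Relation.Unary.Any as Any using (Any; here; there)
import Data.List.Relation.Unary.Any.Properties as Any
open import Data.List.Relation.Unary.Unique.Propositional using (Unique)
open import Data.List.Relation.Unary.Unique.Propositional.Properties
  using (filter⁺; ++⁺; allFin⁺; cartesianProduct⁺)
import Data.List.Relation.Unary.Unique.DecPropositional.Properties as UniqueDec
import Data.List.Relation.Unary.Unique.DecSetoid.Properties as UniqueDecSetoid
open import Data.Nat.Base
  using (ℕ; zero; suc; NonZero; z≤n; s≤s; _+_; _*_; _≤_; _≥_)
open import Data.Nat.DivMod using (_/_; /-monoˡ-≤; m*n/n≡m)
open import Data.Nat.Properties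
  using (_≟_; ≡-decSetoid; ≤-trans; ≤-reflexive; +-monoˡ-≤; +-mono-≤;
         *-monoˡ-≤; <⇒≱; suc-injective; module ≤-Reasoning)
open import Data.Nat.Tactic.RingSolver using (solve-∀)
open import Data.Product.Base using (∃; _×_; _,_; proj₁; proj₂)
open import Data.Sum.Base using (inj₁; inj₂)
open import Function.Base using (_∘_; id)
import Relation.Binary.Construct.On as On
open import Relation.Binary.Core using (Rel)
open import Relation.Binary.Definitions using (Symmetric)
open import Relation.Binary.PropositionalEquality
  using (_≡_; _≢_; refl; sym; trans; cong; subst; setoid)
open import Relation.Nullary.Decidable using (Dec; yes; no; ¬?; _×-dec_)
open import Relation.Nullary.Negation using (¬_; contradiction)

-- Counting with repetition-free lists, and minimisers.

module _ {a} {A : Set a} where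

  ∈⇒↭∷ : ∀ {x : A} {xs} → x ∈ xs → ∃ λ ys → xs ↭ x ∷ ys
  ∈⇒↭∷ x∈xs with ys , zs , eq ← ∈-∃++ x∈xs =
    ys ++ zs , ↭-trans (↭-reflexive eq) (shift _ ys zs)

  unique-resp-↭ : ∀ {xs ys : List A} → xs ↭ ys → Unique xs → Unique ys
  unique-resp-↭ = Unique-resp-↭ (setoid A) ∘ ↭⇒↭ₛ

  -- A permutation brings the head of `xs` to the front of `ys`; the tail of `xs` avoids that head,
  -- so it embeds in the rest. All later counts rest on this.
  unique-⊆⇒length≤ : ∀ {xs ys : List A} → Unique xs → xs ⊆ ys → length xs ≤ length ys
  unique-⊆⇒length≤ [] _ = z≤n
  unique-⊆⇒length≤ {x ∷ xs} {ys} (x∉xs ∷ xs!) xs⊆ys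
    with zs , ys↭ ← ∈⇒↭∷ (xs⊆ys (here refl)) =
    subst (suc (length xs) ≤_) (sym (↭-length ys↭)) (s≤s (unique-⊆⇒length≤ xs! xs⊆zs))
    where
    xs⊆zs : xs ⊆ zs
    xs⊆zs z∈xs with ∈-resp-↭ ys↭ (xs⊆ys (there z∈xs))
    ... | here refl  = contradiction refl (All.lookup x∉xs z∈xs)
    ... | there z∈zs = z∈zs

  unique-disjoint⇒length≤ : ∀ {xs ys zs : List A} → Unique xs → Unique ys → Disjoint xs ys →
    xs ⊆ zs → ys ⊆ zs → length xs + length ys ≤ length zs
  unique-disjoint⇒length≤ {xs} {ys} {zs} xs! ys! xs#ys xs⊆zs ys⊆zs =
    subst (_≤ length zs) (length-++ xs) (unique-⊆⇒length≤ (++⁺ xs! ys! xs#ys) sub)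
    where
    sub : xs ++ ys ⊆ zs
    sub z∈ with ∈-++⁻ xs z∈
    ... | inj₁ z∈xs = xs⊆zs z∈xs
    ... | inj₂ z∈ys = ys⊆zs z∈ys

  allPairs-lookup : ∀ {ℓ} {R : Rel A ℓ} → Symmetric R → ∀ {xs} → AllPairs R xs →
    ∀ {x y} → x ∈ xs → y ∈ xs → x ≢ y → R x y
  allPairs-lookup sy (_  ∷ _)   (here refl) (here refl) x≢y = contradiction refl x≢y
  allPairs-lookup sy (rs ∷ _)   (here refl) (there y∈)  _   = All.lookup rs y∈
  allPairs-lookup sy (rs ∷ _)   (there x∈)  (here refl) _   = sy (All.lookup rs x∈)
  allPairs-lookup sy (_  ∷ rss) (there x∈)  (there y∈)  x≢y = allPairs-lookup sy rss x∈ y∈ x≢y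

  minimiser : ∀ (f : A → ℕ) x xs →
    ∃ λ v → v ∈ x ∷ xs × (∀ {u} → u ∈ x ∷ xs → f v ≤ f u)
  minimiser f x xs = v , v∈ , minimal
    where
    v = argmin f x xs
    v∈ : v ∈ x ∷ xs
    v∈ with argmin-sel f x xs
    ... | inj₁ v≡x  = here v≡x
    ... | inj₂ v∈xs = there v∈xs
    minimal : ∀ {u} → u ∈ x ∷ xs → f v ≤ f u
    minimal (here refl) = f[argmin]≤f[⊤] {f = f} x xs
    minimal (there u∈)  = All.lookup (f[argmin]≤f[xs] {f = f} x xs) u∈

-- Total colours, rainbow triples and covers of induced subgraphs.

module _ {n : ℕ} (G : EdgeColouredGraph n) where
  open EdgeColouredGraph G

  -- The colour as a total function, with junk value 0 on non-adjacent pairs.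
  col : Fin n → Fin n → ℕ
  col u v with adj? u v
  ... | yes uv = colour u v uv
  ... | no _   = 0

  col≡colour : ∀ {u v} (uv : Adj u v) → col u v ≡ colour u v uv
  col≡colour {u} {v} uv with adj? u v
  ... | yes _  = refl
  ... | no ¬uv = contradiction uv ¬uv

  col-sym : ∀ {u v} → Adj u v → col u v ≡ col v u
  col-sym uv = trans (col≡colour uv) (trans (colour-sym uv) (sym (col≡colour (symm uv))))

  -- Using `col`, the colour conditions need no adjacency proof, so this is a plain product of
  -- decidable conditions. A search over all triples then replaces classical reasoning.
  Rainbow : Fin n → Fin n → Fin n → Set
  Rainbow u v w = (Adj u v × Adj v w × Adj u w) ×
    (col u v ≢ col v w × col u v ≢ col u w × col v w ≢ col u w)

  rainbow? : ∀ u v w → Dec (Rainbow u v w)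
  rainbow? u v w = (adj? u v ×-dec adj? v w ×-dec adj? u w) ×-dec
    (¬? (_ ≟ _) ×-dec ¬? (_ ≟ _) ×-dec ¬? (_ ≟ _))

  rainbow⇒triangle : ∀ {u v w} → Rainbow u v w → RainbowTriangle G
  rainbow⇒triangle ((uv , vw , uw) , (p , q , r))
    rewrite col≡colour uv | col≡colour vw | col≡colour uw = record
    { uv = uv; vw = vw; uw = uw; uv≢vw = p; uv≢uw = q; vw≢uw = r }

  -- Induced subgraphs are given by their vertex lists: the induction shrinks `vs` while `G` stays
  -- fixed, and degrees are taken inside `vs`.
  neighbours : List (Fin n) → Fin n → List (Fin n)
  neighbours vs v = filter (adj? v) vs

  degree : List (Fin n) → Fin n → ℕ
  degree vs v = length (neighbours vs v)

  -- es and cs need only contain the edges and colours induced on vs, so size is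
  -- an upper bound for e + c and the induction never counts exactly.
  record Cover (vs : List (Fin n)) : Set where
    field
      es  : List (Fin n × Fin n)
      cs  : List ℕ
      ∈es : ∀ {u w} → u ∈ vs → w ∈ vs → u < w → Adj u w → (u , w) ∈ es
      ∈cs : ∀ {u w} → u ∈ vs → w ∈ vs → Adj u w → col u w ∈ cs

    size : ℕ
    size = length es + length cs

  singletonCover : ∀ v → Cover [ v ]
  singletonCover v = record
    { es = []; cs = []
    ; ∈es = λ { (here refl) (here refl) _ vv → contradiction vv (irrefl refl) }
    ; ∈cs = λ { (here refl) (here refl) vv → contradiction vv (irrefl refl) }
    }

  -- Graphs without rainbow triangles: small covers by induction on the number of vertices.

  module _ (rainbow-free : ∀ {u v w} → ¬ Rainbow u v w) where

    module Extend {vs ws : List (Fin n)} (vs! : Unique vs) {v : Fin n} (vs↭ : vs ↭ v ∷ ws)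
                  (v-min : ∀ {u} → u ∈ vs → degree vs v ≤ degree vs u) (C : Cover ws) where
      open Cover C

      -- Covers list edges in increasing orientation, and `v` may be either endpoint. The junk case
      -- `w` equal to `v` never arises for a neighbour.
      orient : Fin n → Fin n × Fin n
      orient w with v <? w
      ... | yes _ = v , w
      ... | no _  = w , v

      orient-< : ∀ {w} → v < w → orient w ≡ (v , w)
      orient-< {w} v<w with v <? w
      ... | yes _  = refl
      ... | no v≮w = contradiction v<w v≮w

      orient-> : ∀ {w} → w < v → orient w ≡ (w , v)
      orient-> {w} w<v with v <? w
      ... | yes v<w = contradiction w<v (<-asym v<w)
      ... | no _    = refl

      -- Novelty is tested against the list `cs` that is to be extended. As `cs` contains every
      -- colour inside `ws`, a new colour occurs in `vs` only on edges at `v`.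
      new? : ∀ w → Dec (¬ Any (col v w ≡_) cs)
      new? w = ¬? (Any.any? (col v w ≟_) cs)

      newNeighbours : List (Fin n)
      newNeighbours = filter new? (neighbours vs v)

      picked : List (Fin n)
      picked = deduplicate (λ x y → col v x ≟ col v y) newNeighbours

      picked-distinct : AllPairs (λ x y → col v x ≢ col v y) picked
      picked-distinct =
        UniqueDecSetoid.deduplicate-! (On.decSetoid ≡-decSetoid (col v)) newNeighbours

      picked! : Unique picked
      picked! = AllPairs.map (λ c≢ x≡y → c≢ (cong (col v) x≡y)) picked-distinct

      picked⁻ : ∀ {x} → x ∈ picked → x ∈ vs × Adj v x × ¬ (col v x ∈ cs)
      picked⁻ x∈
        with x∈N , x-new ← ∈-filter⁻ new? {xs = neighbours vs v} (∈-deduplicate⁻ _ newNeighbours x∈)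
        with x∈vs , vx ← ∈-filter⁻ (adj? v) {xs = vs} x∈N = x∈vs , vx , x-new

      neighbour∈ws : ∀ {x} → x ∈ vs → Adj v x → x ∈ ws
      neighbour∈ws x∈vs vx with ∈-resp-↭ vs↭ x∈vs
      ... | here refl  = contradiction vx (irrefl refl)
      ... | there x∈ws = x∈ws

      picked-independent : ∀ {x y} → x ∈ picked → y ∈ picked → ¬ Adj x y
      picked-independent x∈ y∈ xy
        with x∈vs , vx , x-new ← picked⁻ x∈ | y∈vs , vy , y-new ← picked⁻ y∈ =
        rainbow-free ((vx , xy , vy)
          , (λ eq → x-new (subst (_∈ cs) (sym eq) xy∈cs))
          -- Adjacent vertices are different, so `x` and `y` represent different new colours.
          , allPairs-lookup (_∘ sym) picked-distinct x∈ y∈ (λ x≡y → irrefl x≡y xy)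
          , (λ eq → y-new (subst (_∈ cs) eq xy∈cs)))
        where xy∈cs = ∈cs (neighbour∈ws x∈vs vx) (neighbour∈ws y∈vs vy) xy

      neighbours⊆ : ∀ u → neighbours vs u ⊆ vs
      neighbours⊆ u = proj₁ ∘ ∈-filter⁻ (adj? u)

      picked⇒degree+picked≤ : ∀ {x} → x ∈ picked → degree vs x + length picked ≤ length vs
      picked⇒degree+picked≤ {x} x∈ = unique-disjoint⇒length≤ (filter⁺ (adj? x) vs!) picked!
        (λ (z∈N , z∈) → picked-independent x∈ z∈ (proj₂ (∈-filter⁻ (adj? x) {xs = vs} z∈N)))
        (neighbours⊆ x) (proj₁ ∘ picked⁻)

      -- The left side is exactly what `v` adds to the size of a cover: its edges and one entry per
      -- new colour.
      degree+picked≤ : degree vs v + length picked ≤ length vs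
      degree+picked≤ = go picked refl
        where
        -- The case split is on a copy of `picked` tied to it by an equation, so that the facts
        -- about `picked` survive. If nothing is picked, the bound only says that the neighbours of
        -- `v` lie in `vs`.
        go : ∀ ps → picked ≡ ps → degree vs v + length ps ≤ length vs
        go [] _ = unique-disjoint⇒length≤ (filter⁺ (adj? v) vs!) [] (λ ()) (neighbours⊆ v) (λ ())
        go (x ∷ _) eq = subst (λ ps → degree vs v + length ps ≤ length vs) eq
          (≤-trans (+-monoˡ-≤ (length picked) (v-min (proj₁ (picked⁻ x∈)))) (picked⇒degree+picked≤ x∈))
          where
          x∈ : x ∈ picked
          x∈ = subst (x ∈_) (sym eq) (here refl)

      es′ : List (Fin n × Fin n)
      es′ = map orient (neighbours vs v) ++ es

      cs′ : List ℕ
      cs′ = map (col v) picked ++ cs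

      orient∈es′ : ∀ {w} → w ∈ vs → Adj v w → orient w ∈ es′
      orient∈es′ w∈vs vw = ∈-++⁺ˡ (∈-map⁺ orient (∈-filter⁺ (adj? v) w∈vs vw))

      ∈es′ : ∀ {u w} → u ∈ vs → w ∈ vs → u < w → Adj u w → (u , w) ∈ es′
      ∈es′ u∈ w∈ u<w uw with ∈-resp-↭ vs↭ u∈ | ∈-resp-↭ vs↭ w∈
      ... | here refl | _         = subst (_∈ es′) (orient-< u<w) (orient∈es′ w∈ uw)
      ... | _         | here refl = subst (_∈ es′) (orient-> u<w) (orient∈es′ u∈ (symm uw))
      ... | there u∈ws | there w∈ws = ∈-++⁺ʳ _ (∈es u∈ws w∈ws u<w uw)

      col∈cs′ : ∀ {w} → w ∈ vs → Adj v w → col v w ∈ cs′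
      col∈cs′ {w} w∈ vw with Any.any? (col v w ≟_) cs
      ... | yes old = ∈-++⁺ʳ _ old
      -- Deduplication may drop `w` itself. What survives is that some vertex has the colour
      -- `col v w`, a property that respects equality of colours.
      ... | no new  = ∈-++⁺ˡ (Any.map⁺ (Any.deduplicate⁺ _ (λ x≡y eq → trans eq (sym x≡y))
        (Any.map (cong (col v)) (∈-filter⁺ new? (∈-filter⁺ (adj? v) w∈ vw) new))))

      ∈cs′ : ∀ {u w} → u ∈ vs → w ∈ vs → Adj u w → col u w ∈ cs′
      ∈cs′ u∈ w∈ uw with ∈-resp-↭ vs↭ u∈ | ∈-resp-↭ vs↭ w∈
      ... | here refl | _         = col∈cs′ w∈ uw
      ... | _         | here refl = subst (_∈ cs′) (col-sym (symm uw)) (col∈cs′ u∈ (symm uw))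
      ... | there u∈ws | there w∈ws = ∈-++⁺ʳ _ (∈cs u∈ws w∈ws uw)

      cover : Cover vs
      cover = record { es = es′; cs = cs′; ∈es = ∈es′; ∈cs = ∈cs′ }

      size-cover : Cover.size cover ≤ length vs + size
      size-cover = begin
        length es′ + length cs′
          ≡⟨ cong (_+ length cs′) (trans (length-++ (map orient (neighbours vs v)))
               (cong (_+ length es) (length-map orient (neighbours vs v)))) ⟩
        (degree vs v + length es) + length cs′
          ≡⟨ cong (degree vs v + length es +_) (trans (length-++ (map (col v) picked))
               (cong (_+ length cs) (length-map (col v) picked))) ⟩
        (degree vs v + length es) + (length picked + length cs)
          ≡⟨ interchange (degree vs v) (length es) (length picked) (length cs) ⟩
        (degree vs v + length picked) + (length es + length cs)
          ≤⟨ +-monoˡ-≤ size degree+picked≤ ⟩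
        length vs + size ∎
        where
        open ≤-Reasoning
        interchange : ∀ a b c d → (a + b) + (c + d) ≡ (a + c) + (b + d)
        interchange = solve-∀

    -- With k = `suc m` vertices this says that the size is below k(k+1)/2, doubled to keep division
    -- out of the induction; the `suc` on the size carries strictness. Passing to k+1 vertices adds
    -- at most k+1, the gap between consecutive triangular numbers.
    smallCover : ∀ m {vs} → Unique vs → length vs ≡ suc m →
      ∃ λ (C : Cover vs) → suc (Cover.size C) * 2 ≤ suc m * (suc m + 1)
    -- The size is 0 and the bound reads 2 ≤ 2. The strict bound would fail for zero vertices, so
    -- the induction starts at one.
    smallCover zero {v ∷ []} _ _ = singletonCover v , s≤s (s≤s z≤n)
    smallCover (suc m) {vs@(x ∷ xs)} vs! len
      with v , v∈ , v-min ← minimiser (degree vs) x xs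
      with ws , vs↭ ← ∈⇒↭∷ v∈
      with C , C≤ ← smallCover m (AllPairs.tail (unique-resp-↭ vs↭ vs!)) (suc-injective (trans (sym (↭-length vs↭)) len))
      = cover , (begin
        suc (Cover.size cover) * 2           ≤⟨ *-monoˡ-≤ 2 (s≤s size-cover) ⟩
        suc (length vs + Cover.size C) * 2   ≡⟨ cong (λ k → suc (k + Cover.size C) * 2) len ⟩
        suc (suc (suc m) + Cover.size C) * 2 ≡⟨ expand m (Cover.size C) ⟩
        suc (Cover.size C) * 2 + suc (suc m) * 2 ≤⟨ +-monoˡ-≤ (suc (suc m) * 2) C≤ ⟩
        suc m * (suc m + 1) + suc (suc m) * 2 ≡⟨ triangular m ⟩
        suc (suc m) * (suc (suc m) + 1)      ∎)
      where
      open Extend vs! vs↭ v-min C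
      open ≤-Reasoning
      expand : ∀ m s → suc (suc (suc m) + s) * 2 ≡ suc s * 2 + suc (suc m) * 2
      expand = solve-∀
      triangular : ∀ m → suc m * (suc m + 1) + suc (suc m) * 2 ≡ suc (suc m) * (suc (suc m) + 1)
      triangular = solve-∀

  -- From covers back to the edge and colour counts of the graph.

  edgePair? : ∀ ((u , v) : Fin n × Fin n) → Dec (u < v × Adj u v)
  edgePair? (u , v) with u <? v | adj? u v
  ... | yes u<v | yes uv = yes (u<v , uv)
  ... | yes _   | no ¬uv = no (¬uv ∘ proj₂)
  ... | no u≮v  | _      = no (u≮v ∘ proj₁)

  -- Moves the edge count to pairs of vertices, whose lists are visibly repetition-free. `edgePair?`
  -- splits on the same tests as `edge?`, so both sides reduce together.
  length-edges : ∀ ps → length (mapMaybe (edge? G) ps) ≡ length (filter edgePair? ps)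
  length-edges [] = refl
  length-edges ((u , v) ∷ ps) with u <? v | adj? u v
  ... | yes _ | yes _ = cong suc (length-edges ps)
  ... | yes _ | no _  = length-edges ps
  ... | no _  | yes _ = length-edges ps
  ... | no _  | no _  = length-edges ps

  edgeColour∈ : ∀ {cs} → (∀ {u v} → Adj u v → col u v ∈ cs) →
    ∀ ps → map (edgeColour G) (mapMaybe (edge? G) ps) ⊆ cs
  edgeColour∈ col∈ ((u , v) ∷ ps) c∈ with u <? v | adj? u v
  edgeColour∈ {cs} col∈ ((u , v) ∷ ps) (here refl) | yes _ | yes uv =
    subst (_∈ cs) (col≡colour uv) (col∈ uv)
  edgeColour∈ col∈ ((u , v) ∷ ps) (there c∈) | yes _ | yes _ = edgeColour∈ col∈ ps c∈
  ... | yes _ | no _  = edgeColour∈ col∈ ps c∈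
  ... | no _  | yes _ = edgeColour∈ col∈ ps c∈
  ... | no _  | no _  = edgeColour∈ col∈ ps c∈

  -- Each count is the length of a repetition-free list, of increasing adjacent pairs or of colours,
  -- contained in `es` or `cs` respectively.
  count≤size : (C : Cover (allFin n)) → edgeCount G + colourCount G ≤ Cover.size C
  count≤size C = +-mono-≤
    (subst (_≤ length es) (sym (length-edges pairs))
      (unique-⊆⇒length≤ (filter⁺ edgePair? (cartesianProduct⁺ (allFin⁺ n) (allFin⁺ n)))
        (λ p∈ → let _ , u<v , uv = ∈-filter⁻ edgePair? {xs = pairs} p∈
                in ∈es (∈-allFin _) (∈-allFin _) u<v uv)))
    (unique-⊆⇒length≤ (UniqueDec.deduplicate-! _≟_ colours)
      (edgeColour∈ (∈cs (∈-allFin _) (∈-allFin _)) pairs ∘ ∈-deduplicate⁻ _≟_ colours))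
    where
    open Cover C
    pairs = cartesianProduct (allFin n) (allFin n)
    colours = map (edgeColour G) (edges G)

theorem1 : (n : ℕ) .{{_ : NonZero n}} (G : EdgeColouredGraph n) →
    edgeCount G + colourCount G ≥ n * (n + 1) / 2 → RainbowTriangle G
theorem1 n@(suc m) G e+c≥ with any? (λ u → any? (λ v → any? (λ w → rainbow? G u v w)))
... | yes (_ , _ , _ , r) = rainbow⇒triangle G r
... | no ¬r
  with C , C≤ ← smallCover G (λ r → ¬r (_ , _ , _ , r)) m (allFin⁺ n) (length-tabulate {n = n} id) =
  contradiction e+c≥ (<⇒≱ (begin-strict
    edgeCount G + colourCount G ≤⟨ count≤size G C ⟩
    Cover.size C                <⟨ ≤-reflexive (sym (m*n/n≡m (suc (Cover.size C)) 2)) ⟩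
    -- Halving is exact on the doubled size and monotone, so the doubled bound passes to the floor
    -- quotient.
    suc (Cover.size C) * 2 / 2  ≤⟨ /-monoˡ-≤ 2 C≤ ⟩
    n * (n + 1) / 2             ∎))
  where open ≤-Reasoning
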